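{- Let $R$ be a Kock--Lawvere ring that is a $\mathbb{Q}$-algebra. Let $n \in \mathbb{N}$, let $k=(k_0,\dots,k_{n-1}) \in \mathbb{N}^n$, and let $f\colon R^n \to R$ be any function. For all $x\in R^n$ and all $d=(d_0,\dots,d_{n-1})\in D_{k_0} \times \dots \times D_{k_{n-1}}$, we have \[ f(x+d)=\sum_{\alpha \in \mathbb{N}^n,\ |\alpha| \leq |k|} \partial[\alpha]f(x)\, \frac{d^{\alpha}}{\alpha!}. \]
   Context: Logical setting: the reasoning is intuitionistic, so neither the law of excluded middle nor the axiom of choice is available (with excluded middle no ring as below exists). The axiom of unique choice is allowed: if for every $a\in A$ there is a unique $b\in B$ with $P(a,b)$, one obtains a function $F\colon A\to B$ such that $P(a,F(a))$ for all $a$. Rings are commutative with unit, $\mathbb{N}$ contains $0$, and indices start at $0$. For a commutative ring $R$ and $k\in\mathbb{N}$, $D_k=\{r\in R : r^{k+1}=0\}$, and $D=D_1=\{r\in R: r^2=0\}$. $R$ is $1$-Kock--Lawvere if it is nontrivial ($0\neq 1$) and for every function $g\colon D\to R$ there is a unique $b\in R$ such that $g(d)=g(0)+bd$ for all $d\in D$. $R$ is Kock--Lawvere if it is nontrivial and for every $k\in\mathbb{N}$ and every function $g\colon D_k\to R$ there are unique $b_0,\dots,b_{k-1}\in R$ such that $g(d)=g(0)+\sum_{i<k} b_i d^{i+1}$ for all $d\in D_k$. (Kock--Lawvere implies $1$-Kock--Lawvere.) Partial derivatives: if $R$ is $1$-Kock--Lawvere, $f\colon R^n\to R$ is any function and $i<n$,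 then $\partial_i f\colon R^n\to R$ is the function sending $x$ to the unique $b\in R$ such that $f(x_0,\dots,x_i+d,\dots,x_{n-1})=f(x)+b\,d$ for all $d\in D$. $\partial_i^m$ denotes the $m$-fold iterate, with $\partial_i^0f=f$. For $\alpha\in\mathbb{N}^n$: $|\alpha|=\sum_{j<n}\alpha_j$, $\alpha!=\prod_{j<n}\alpha_j!$, $d^\alpha=\prod_{j<n}d_j^{\alpha_j}$, and $\partial[\alpha]f$ is the mixed derivative obtained by applying the operators $\partial_j^{\alpha_j}$, for all $j<n$, successively to $f$ (partial derivatives commute, so the order is immaterial). -}

module Defs where

open import Algebra.Bundles using (CommutativeRing)
open import Algebra.Morphism.Structures using (module RingMorphisms)
import Algebra.Properties.CommutativeMonoid.Sum as BigOp
import Algebra.Properties.Semiring.Exp as Exp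
open import Data.Fin.Base using (Fin; zero; suc; toℕ)
open import Data.Integer.Base using (+_)
open import Data.Nat.Base as ℕ using (ℕ; zero; suc; NonZero; _!; _∸_)
open import Data.Nat.GeneralisedArithmetic using (fold)
import Data.Nat.Properties as ℕ
open import Data.Product using (Σ; ∃!; _,_; proj₁; proj₂)
open import Data.Rational.Base as ℚ using (ℚ)
open import Data.Vec.Functional using (Vector; []; _∷_; map; foldr; updateAt; zipWith)
import Data.Vec.Functional.Relation.Binary.Equality.Setoid as VecEquality
open import Function.Base using (id)
open import Function.Bundles using (Func)
open import Level using (_⊔_)
open import Relation.Binary.Bundles using (Setoid)
import Relation.Binary.Construct.On as On
open import Relation.Nullary.Negation using (¬_)
open import Relation.Unary using (Pred; _∈_)

open Func using (to; cong)

∣_∣ : ∀ {n} → Vector ℕ n → ℕ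
∣ α ∣ = foldr ℕ._+_ 0 α

infix 8 _!ᵐ

_!ᵐ : ∀ {n} → Vector ℕ n → ℕ
α !ᵐ = foldr ℕ._*_ 1 (map _! α)

_!ᵐ≢0 : ∀ {n} (α : Vector ℕ n) → NonZero (α !ᵐ)
_!ᵐ≢0 {zero}  α = _
_!ᵐ≢0 {suc n} α =
  ℕ.m*n≢0 _ _ {{α zero ℕ.!≢0}} {{(λ i → α (suc i)) !ᵐ≢0}}

1/_! : ∀ {n} → Vector ℕ n → ℚ
1/ α ! = ((+ 1) ℚ./ (α !ᵐ)) {{α !ᵐ≢0}}

-- Equality in R is the ring's own _≈_; accordingly a function between sets
-- built from R is a Func, i.e. a map that respects these equalities.
module OverRing {c ℓ} (R : CommutativeRing c ℓ) where

  open CommutativeRing R hiding (zero)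
  open Exp semiring using (_^_)
  open BigOp +-commutativeMonoid using (sum-syntax; sum⁺-syntax)
  open BigOp *-commutativeMonoid using () renaming (sum to product)
  open VecEquality setoid using (_≋_; ≋-setoid)

  D : ℕ → Pred Carrier ℓ
  D k r = r ^ suc k ≈ 0#

  D-setoid : ℕ → Setoid (c ⊔ ℓ) ℓ
  D-setoid k = On.setoid {B = Σ Carrier (D k)} setoid proj₁

  0∈D : ∀ k → 0# ∈ D k
  0∈D k = zeroˡ (0# ^ k)

  record 1-KockLawvere : Set (c ⊔ ℓ) where
    field
      nontrivial : ¬ (0# ≈ 1#)
      slope      : (g : Func (D-setoid 1) setoid) →
                   ∃! _≈_ λ b →
                   ∀ d (d∈D : d ∈ D 1) → to g (d , d∈D) ≈ to g (0# , 0∈D 1) + b * d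

  record KockLawvere : Set (c ⊔ ℓ) where
    field
      nontrivial   : ¬ (0# ≈ 1#)
      coefficients : ∀ k (g : Func (D-setoid k) setoid) →
                     ∃! (_≋_ {k}) λ b →
                     ∀ d (d∈D : d ∈ D k) →
                     to g (d , d∈D) ≈ to g (0# , 0∈D k) + ∑[ i < k ] (b i * d ^ suc (toℕ i))

  KockLawvere⇒1-KockLawvere : KockLawvere → 1-KockLawvere
  KockLawvere⇒1-KockLawvere kl = record
    { nontrivial = nontrivial
    ; slope      = λ g → let (b , isCoeff , unique) = coefficients 1 g in
        b zero
        , (λ d d∈D → trans (isCoeff d d∈D) (+-congˡ (simplify (b zero) d)))
        , (λ {b′} isSlope → unique {λ _ → b′}
             (λ d d∈D → trans (isSlope d d∈D) (+-congˡ (sym (simplify b′ d)))) zero)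
    }
    where
    open KockLawvere kl
    simplify : ∀ b d → b * (d * 1#) + 0# ≈ b * d
    simplify b d = trans (+-identityʳ _) (*-congˡ (*-identityʳ d))

  record ℚ-Algebra : Set (c ⊔ ℓ) where
    open RingMorphisms ℚ.+-*-rawRing rawRing using (IsRingHomomorphism)
    field
      ι                  : ℚ → Carrier
      isRingHomomorphism : IsRingHomomorphism ι

    infixr 7 _·_

    _·_ : ℚ → Carrier → Carrier
    q · r = ι q * r

  infixl 6 _+ᵛ_
  infixr 8 _^ᵐ_

  _+ᵛ_ : ∀ {n} → Vector Carrier n → Vector Carrier n → Vector Carrier n
  _+ᵛ_ = zipWith _+_

  _^ᵐ_ : ∀ {n} → Vector Carrier n → Vector ℕ n → Carrier
  d ^ᵐ α = product (zipWith _^_ d α)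

  -- The sum of F α over all α ∈ ℕⁿ with ∣ α ∣ ≤ m: the first entry a ranges
  -- over 0, …, m and the remaining entries over all β with ∣ β ∣ ≤ m ∸ a.
  multiSum : ∀ n (m : ℕ) → (Vector ℕ n → Carrier) → Carrier
  multiSum zero    m F = F []
  multiSum (suc n) m F =
    ∑[ a ≤ m ] multiSum n (m ∸ toℕ a) (λ β → F (toℕ a ∷ β))

  syntax multiSum n m (λ α → t) = ∑[ α ∈ℕ^ n ∣≤ m ] t

  Map : ℕ → Set (c ⊔ ℓ)
  Map n = Func (≋-setoid n) setoid

  updateAt-cong : ∀ {n} {x y : Vector Carrier n} {d e} (i : Fin n) →
                  x ≋ y → d ≈ e → updateAt x i (_+ d) ≋ updateAt y i (_+ e)
  updateAt-cong zero    x≋y d≈e zero    = +-cong (x≋y zero) d≈e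
  updateAt-cong zero    x≋y d≈e (suc j) = x≋y (suc j)
  updateAt-cong (suc i) x≋y d≈e zero    = x≋y zero
  updateAt-cong (suc i) x≋y d≈e (suc j) = updateAt-cong i (λ l → x≋y (suc l)) d≈e j

  updateAt-+0 : ∀ {n} (x : Vector Carrier n) (i : Fin n) → updateAt x i (_+ 0#) ≋ x
  updateAt-+0 x zero    zero    = +-identityʳ _
  updateAt-+0 x zero    (suc j) = refl
  updateAt-+0 x (suc i) zero    = refl
  updateAt-+0 x (suc i) (suc j) = updateAt-+0 (λ l → x (suc l)) i j

  module PartialDerivatives (kl : 1-KockLawvere) where

    open 1-KockLawvere kl

    restrict : ∀ {n} → Map n → Fin n → Vector Carrier n → Func (D-setoid 1) setoid
    restrict f i x = record
      { to   = λ (d , _) → to f (updateAt x i (_+ d))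
      ; cong = λ d≈e → cong f (updateAt-cong i (λ _ → refl) d≈e)
      }

    ∂-spec : ∀ {n} (i : Fin n) (f : Map n) (x : Vector Carrier n) →
             ∃! _≈_ λ b → ∀ d → d ∈ D 1 → to f (updateAt x i (_+ d)) ≈ to f x + b * d
    ∂-spec i f x =
      let (b , isSlope , unique) = slope (restrict f i x)
          f[x+0]≈f[x] = cong f (updateAt-+0 x i)
      in b
       , (λ d d∈D → trans (isSlope d d∈D) (+-congʳ f[x+0]≈f[x]))
       , (λ h → unique (λ d d∈D → trans (h d d∈D) (+-congʳ (sym f[x+0]≈f[x]))))

    ∂ : ∀ {n} → Fin n → Map n → Map n
    ∂ i f = record
      { to   = λ x → proj₁ (∂-spec i f x)
      ; cong = λ {x} {y} x≋y →
          let (_ , _ , unique) = ∂-spec i f x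
              (_ , isSlope , _) = ∂-spec i f y
          in unique (λ d d∈D →
               trans (cong f (updateAt-cong i x≋y refl))
              (trans (isSlope d d∈D) (+-congʳ (cong f (λ j → sym (x≋y j))))))
      }

    ∂^ : ∀ {n} → Fin n → ℕ → Map n → Map n
    ∂^ i m f = fold f (∂ i) m

    -- ∂₀^α₀ (∂₁^α₁ (… f))
    ∂[_] : ∀ {n} → Vector ℕ n → Map n → Map n
    ∂[ α ] f = foldr (λ j h → ∂^ j (α j) h) f id

{-# OPTIONS --safe #-}
module Submission where

-- In one variable, f(x + d) is a polynomial Σ bₐ dᵃ on D k by the Kock–Lawvere
-- axiom. Replacing d by d + e with d ∈ D (k - 1) and e ∈ D 1 and comparing slopes
-- in e shows that ∂f is the formal derivative Σ (a + 1) bₐ₊₁ dᵃ on D (k - 1), so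
-- induction on k gives a! bₐ = ∂ᵃf(x). In several variables, expand first in the
-- last n - 1 variables and then in the first one, which is the order in which ∂[ α ]
-- applies the operators, so that partial derivatives never have to be commuted.
-- This yields the sum over the box α ≤ k; the other terms with ∣ α ∣ ≤ ∣ k ∣ vanish.

open import Defs
open import Algebra.Bundles using (CommutativeRing)
open import Algebra.Morphism.Structures using (module RingMorphisms)
import Algebra.Properties.CommutativeSemigroup as CommutativeSemigroupProperties
import Algebra.Properties.Semiring.Exp as Exp
import Algebra.Properties.Semiring.Mult as SemiringMult
import Algebra.Properties.Semiring.Sum as SemiringSum
open import Data.Fin.Base using (Fin; zero; suc; toℕ)
open import Data.Fin.Properties using (toℕ≤pred[n])
import Data.Integer.Base as ℤ
import Data.Integer.Properties as ℤ
open import Data.Nat.Base as ℕ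
  using (ℕ; zero; suc; NonZero; _!; _∸_; _≤_; _<_; z≤n; s≤s; z<s; s<s)
open import Data.Nat.GeneralisedArithmetic using (iterate-is-fold)
import Data.Nat.Properties as ℕ
open import Data.Product using (_,_; proj₁; proj₂)
open import Data.Rational.Base as ℚ using (ℚ; toℚᵘ; fromℚᵘ)
import Data.Rational.Properties as ℚ
open import Data.Rational.Unnormalised.Base as ℚᵘ using (mkℚᵘ; *≡*)
import Data.Rational.Unnormalised.Properties as ℚᵘ
open import Data.Vec.Functional using (Vector; []; _∷_; head; tail; updateAt; foldr)
import Data.Vec.Functional.Relation.Binary.Equality.Setoid as VecEquality
open import Function.Base using (id; _∘_)
open import Function.Bundles using (Func)
open import Relation.Binary.PropositionalEquality as ≡ using (_≡_)
import Relation.Binary.Reasoning.Setoid as ≈-Reasoning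
open import Relation.Unary using (_∈_)

open Func

-- Rational arithmetic of naturals and their reciprocals.

fromℚᵘ-homo-+ : ∀ p q → fromℚᵘ (p ℚᵘ.+ q) ≡ fromℚᵘ p ℚ.+ fromℚᵘ q
fromℚᵘ-homo-+ p q = ℚ.toℚᵘ-injective (begin
  toℚᵘ (fromℚᵘ (p ℚᵘ.+ q))                ≈⟨ ℚ.toℚᵘ-fromℚᵘ (p ℚᵘ.+ q) ⟩
  p ℚᵘ.+ q                                ≈⟨ ℚᵘ.+-cong (ℚ.toℚᵘ-fromℚᵘ p) (ℚ.toℚᵘ-fromℚᵘ q) ⟨
  toℚᵘ (fromℚᵘ p) ℚᵘ.+ toℚᵘ (fromℚᵘ q)    ≈⟨ ℚ.toℚᵘ-homo-+ (fromℚᵘ p) (fromℚᵘ q) ⟨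
  toℚᵘ (fromℚᵘ p ℚ.+ fromℚᵘ q)            ∎)
  where open ≈-Reasoning ℚᵘ.≃-setoid

fromℚᵘ-homo-* : ∀ p q → fromℚᵘ (p ℚᵘ.* q) ≡ fromℚᵘ p ℚ.* fromℚᵘ q
fromℚᵘ-homo-* p q = ℚ.toℚᵘ-injective (begin
  toℚᵘ (fromℚᵘ (p ℚᵘ.* q))                ≈⟨ ℚ.toℚᵘ-fromℚᵘ (p ℚᵘ.* q) ⟩
  p ℚᵘ.* q                                ≈⟨ ℚᵘ.*-cong (ℚ.toℚᵘ-fromℚᵘ p) (ℚ.toℚᵘ-fromℚᵘ q) ⟨
  toℚᵘ (fromℚᵘ p) ℚᵘ.* toℚᵘ (fromℚᵘ q)    ≈⟨ ℚ.toℚᵘ-homo-* (fromℚᵘ p) (fromℚᵘ q) ⟨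
  toℚᵘ (fromℚᵘ p ℚ.* fromℚᵘ q)            ∎)
  where open ≈-Reasoning ℚᵘ.≃-setoid

-- Matching on `suc` exposes each reciprocal as `fromℚᵘ` of an unnormalised fraction, so the claim
-- becomes multiplicativity of `fromℚᵘ` and no gcd is touched.
1/[m*n]≡1/m*1/n : ∀ m n .{{_ : NonZero m}} .{{_ : NonZero n}} .{{_ : NonZero (m ℕ.* n)}} →
                  ℤ.+ 1 ℚ./ (m ℕ.* n) ≡ (ℤ.+ 1 ℚ./ m) ℚ.* (ℤ.+ 1 ℚ./ n)
1/[m*n]≡1/m*1/n (suc m) (suc n) = fromℚᵘ-homo-* (mkℚᵘ (ℤ.+ 1) m) (mkℚᵘ (ℤ.+ 1) n)

n/1*1/n≡1 : ∀ n .{{_ : NonZero n}} → (ℤ.+ n ℚ./ 1) ℚ.* (ℤ.+ 1 ℚ./ n) ≡ ℚ.1ℚ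
n/1*1/n≡1 (suc n) = ≡.trans
  (≡.sym (fromℚᵘ-homo-* (mkℚᵘ (ℤ.+ suc n) 0) (mkℚᵘ (ℤ.+ 1) n)))
  (ℚ.fromℚᵘ-cong {mkℚᵘ (ℤ.+ suc n) 0 ℚᵘ.* mkℚᵘ (ℤ.+ 1) n} {mkℚᵘ (ℤ.+ 1) 0} (*≡* (≡.cong ℤ.+_ (≡.cong suc lemma))))
  where
  lemma : n ℕ.* 1 ℕ.* 1 ≡ n ℕ.+ 0 ℕ.+ 0
  lemma = ≡.trans (≡.trans (ℕ.*-identityʳ _) (ℕ.*-identityʳ n))
                  (≡.sym (≡.trans (ℕ.+-identityʳ _) (ℕ.+-identityʳ n)))

suc/1≡1+n/1 : ∀ n → ℤ.+ suc n ℚ./ 1 ≡ ℚ.1ℚ ℚ.+ (ℤ.+ n ℚ./ 1)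
suc/1≡1+n/1 n = ≡.trans
  (ℚ.fromℚᵘ-cong {mkℚᵘ (ℤ.+ suc n) 0} {mkℚᵘ (ℤ.+ 1) 0 ℚᵘ.+ mkℚᵘ (ℤ.+ n) 0}
     (*≡* (≡.cong (ℤ._* ℤ.+ 1) (≡.sym (≡.cong (λ z → ℤ.+ 1 ℤ.+ z) (ℤ.*-identityʳ (ℤ.+ n)))))))
  (fromℚᵘ-homo-+ (mkℚᵘ (ℤ.+ 1) 0) (mkℚᵘ (ℤ.+ n) 0))

inv! : ℕ → ℚ
inv! a = (ℤ.+ 1 ℚ./ (a !)) {{a ℕ.!≢0}}

module _ {c ℓ} (R : CommutativeRing c ℓ) where

  open CommutativeRing R hiding (zero)
  open OverRing R
  open Exp semiring
  open SemiringMult semiring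
  open SemiringSum semiring
  open VecEquality setoid using (_≋_)
  open CommutativeSemigroupProperties *-commutativeSemigroup using (x∙yz≈y∙xz; interchange)
  open ≈-Reasoning setoid

  -- Powers and nilpotent elements.

  ×-zeroʳ : ∀ n → n × 0# ≈ 0#
  ×-zeroʳ n = trans (sym (sum-replicate n)) (sum-replicate-zero n)

  ∈D⇒^≈0 : ∀ {k m d} → d ∈ D k → k < m → d ^ m ≈ 0#
  ∈D⇒^≈0 {k} {m} {d} d∈D k<m = begin
    d ^ m                          ≡⟨ ≡.cong (d ^_) (ℕ.m+[n∸m]≡n k<m) ⟨
    d ^ (suc k ℕ.+ (m ∸ suc k))    ≈⟨ ^-homo-* d (suc k) (m ∸ suc k) ⟩
    d ^ suc k * d ^ (m ∸ suc k)    ≈⟨ *-congʳ d∈D ⟩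
    0# * d ^ (m ∸ suc k)           ≈⟨ zeroˡ _ ⟩
    0#                             ∎

  D-⊆-suc : ∀ {k d} → d ∈ D k → d ∈ D (suc k)
  D-⊆-suc {k} d∈D = ∈D⇒^≈0 {k} {suc (suc k)} d∈D (ℕ.m<n⇒m<1+n (ℕ.n<1+n k))

  ∈D₁⇒square≈0 : ∀ {e} → e ∈ D 1 → e * e ≈ 0#
  ∈D₁⇒square≈0 e∈D = trans (*-congˡ (sym (*-identityʳ _))) e∈D

  -- The binomial expansion stops after the linear term because `e * e ≈ 0#`. The coefficient of `e`
  -- is the formal derivative of the power.
  ^-+-∈D₁ : ∀ d {e} → e ∈ D 1 → ∀ m → (d + e) ^ suc m ≈ d ^ suc m + suc m × (d ^ m * e)
  ^-+-∈D₁ d {e} e∈D zero = begin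
    (d + e) * 1#                ≈⟨ distribʳ 1# d e ⟩
    d * 1# + e * 1#             ≈⟨ +-congˡ (*-comm e 1#) ⟩
    d * 1# + 1# * e             ≈⟨ +-congˡ (+-identityʳ _) ⟨
    d * 1# + (1# * e + 0#)      ∎
  ^-+-∈D₁ d {e} e∈D (suc m) = begin
    (d + e) * (d + e) ^ suc m                          ≈⟨ *-congˡ (^-+-∈D₁ d e∈D m) ⟩
    (d + e) * (p + suc m × (d ^ m * e))                ≈⟨ distribʳ _ d e ⟩
    d * (p + suc m × (d ^ m * e)) + e * (p + suc m × (d ^ m * e))
                                                       ≈⟨ +-cong left right ⟩
    (d * p + suc m × (p * e)) + p * e                  ≈⟨ +-assoc _ _ _ ⟩
    d * p + (suc m × (p * e) + p * e)                  ≈⟨ +-congˡ (+-comm _ _) ⟩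
    d * p + (p * e + suc m × (p * e))                  ∎
    where
    p = d ^ suc m
    left : d * (p + suc m × (d ^ m * e)) ≈ d * p + suc m × (p * e)
    left = trans (distribˡ d p _) (+-congˡ (trans (×-comm-* (suc m) d _)
             (×-congʳ (suc m) (sym (*-assoc d _ e)))))
    e*de≈0 : e * (d ^ m * e) ≈ 0#
    e*de≈0 = trans (x∙yz≈y∙xz e (d ^ m) e) (trans (*-congˡ (∈D₁⇒square≈0 e∈D)) (zeroʳ _))
    right : e * (p + suc m × (d ^ m * e)) ≈ p * e
    right = begin
      e * (p + suc m × (d ^ m * e))        ≈⟨ distribˡ e p _ ⟩
      e * p + e * (suc m × (d ^ m * e))    ≈⟨ +-cong (*-comm e p) (×-comm-* (suc m) e _) ⟩
      p * e + suc m × (e * (d ^ m * e))    ≈⟨ +-congˡ (×-congʳ (suc m) e*de≈0) ⟩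
      p * e + suc m × 0#                   ≈⟨ +-congˡ (×-zeroʳ (suc m)) ⟩
      p * e + 0#                           ≈⟨ +-identityʳ _ ⟩
      p * e                                ∎

  -- The exponent only has to grow by one: in the power `suc (suc k)` of `d + e`, both the constant
  -- and the linear term in `e` still contain `d ^ suc k`.
  +-∈D : ∀ {k d e} → d ∈ D k → e ∈ D 1 → d + e ∈ D (suc k)
  +-∈D {k} {d} {e} d∈D e∈D = begin
    (d + e) ^ suc (suc k)                              ≈⟨ ^-+-∈D₁ d e∈D (suc k) ⟩
    d ^ suc (suc k) + suc (suc k) × (d ^ suc k * e)
      ≈⟨ +-cong (D-⊆-suc {k} d∈D) (×-congʳ (suc (suc k)) (trans (*-congʳ d∈D) (zeroˡ e))) ⟩
    0# + suc (suc k) × 0#                              ≈⟨ +-identityˡ _ ⟩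
    suc (suc k) × 0#                                   ≈⟨ ×-zeroʳ (suc (suc k)) ⟩
    0#                                                 ∎

  updateAt-+-+ : ∀ {n} (x : Vector Carrier n) (i : Fin n) d e →
                 updateAt (updateAt x i (_+ d)) i (_+ e) ≋ updateAt x i (_+ (d + e))
  updateAt-+-+ x zero    d e zero    = +-assoc _ _ _
  updateAt-+-+ x zero    d e (suc j) = refl
  updateAt-+-+ x (suc i) d e zero    = refl
  updateAt-+-+ x (suc i) d e (suc j) = updateAt-+-+ (tail x) i d e j

  -- Sums over boxes of multi-indices.

  -- Unlike in `multiSum`, the range of the remaining entries does not depend on the first entry, so
  -- iterated expansions produce this sum directly.
  boxSum : ∀ {n} → Vector ℕ n → (Vector ℕ n → Carrier) → Carrier
  boxSum {zero}  k F = F []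
  boxSum {suc n} k F = ∑[ a ≤ head k ] boxSum (tail k) (λ β → F (toℕ a ∷ β))

  boxSum-cong : ∀ {n} (k : Vector ℕ n) {F G : Vector ℕ n → Carrier} →
                (∀ α → F α ≈ G α) → boxSum k F ≈ boxSum k G
  boxSum-cong {zero}  k F≈G = F≈G []
  boxSum-cong {suc n} k F≈G = sum-cong-≋ {suc (head k)} λ a → boxSum-cong (tail k) (λ β → F≈G (toℕ a ∷ β))

  -- Expanding in the first variable last leaves its sum innermost, whereas `boxSum` has it
  -- outermost; this exchange repairs the order.
  boxSum-∑-comm : ∀ {n} (k : Vector ℕ n) m (F : Fin m → Vector ℕ n → Carrier) →
                  boxSum k (λ α → ∑[ i < m ] F i α) ≈ ∑[ i < m ] boxSum k (F i)
  boxSum-∑-comm {zero}  k m F = refl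
  boxSum-∑-comm {suc n} k m F = trans
    (sum-cong-≋ {suc (head k)} λ a → boxSum-∑-comm (tail k) m (λ i β → F i (toℕ a ∷ β)))
    (∑-comm {suc (head k)} {m} λ a i → boxSum (tail k) (λ β → F i (toℕ a ∷ β)))

  -- The summand is a function on `ℕ`, not on a `Fin`, so that one function serves both ranges.
  sum-truncate : ∀ {k m} → k ≤ m → (g : ℕ → Carrier) → (∀ a → k < a → g a ≈ 0#) →
                 ∑[ a ≤ m ] g (toℕ a) ≈ ∑[ a ≤ k ] g (toℕ a)
  sum-truncate {m = m} z≤n g g≈0 =
    +-congˡ (trans (sum-cong-≋ {m} (λ a → g≈0 (suc (toℕ a)) z<s)) (sum-replicate-zero m))
  sum-truncate (s≤s k≤m) g g≈0 =
    +-congˡ (sum-truncate k≤m (g ∘ suc) (λ a k<a → g≈0 (suc a) (s<s k<a)))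

  -- Division by naturals, and total degree against box.

  module _ (ℚ-alg : ℚ-Algebra) where

    open ℚ-Algebra ℚ-alg
    open RingMorphisms ℚ.+-*-rawRing rawRing using (module IsRingHomomorphism)
    open IsRingHomomorphism isRingHomomorphism using (+-homo; *-homo; 0#-homo; 1#-homo)

    ι-homo-× : ∀ n → ι (ℤ.+ n ℚ./ 1) ≈ n × 1#
    ι-homo-× zero    = 0#-homo
    ι-homo-× (suc n) = begin
      ι (ℤ.+ suc n ℚ./ 1)             ≡⟨ ≡.cong ι (suc/1≡1+n/1 n) ⟩
      ι (ℚ.1ℚ ℚ.+ (ℤ.+ n ℚ./ 1))      ≈⟨ +-homo _ _ ⟩
      ι ℚ.1ℚ + ι (ℤ.+ n ℚ./ 1)        ≈⟨ +-cong 1#-homo (ι-homo-× n) ⟩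
      1# + n × 1#                     ∎

    -- The multiple `n × x` is multiplication by the image of `n` under `ι`, and `ι` is
    -- multiplicative. This is what allows solving for a coefficient known up to a factorial.
    1/n·n×x≈x : ∀ n .{{_ : NonZero n}} x → (ℤ.+ 1 ℚ./ n) · (n × x) ≈ x
    1/n·n×x≈x n x = begin
      ι 1/n * (n × x)                  ≈⟨ *-congˡ (×-congʳ n (*-identityˡ x)) ⟨
      ι 1/n * (n × (1# * x))           ≈⟨ *-congˡ (×-assoc-* n 1# x) ⟨
      ι 1/n * (n × 1# * x)             ≈⟨ *-congˡ (*-congʳ (ι-homo-× n)) ⟨
      ι 1/n * (ι (ℤ.+ n ℚ./ 1) * x)    ≈⟨ x∙yz≈y∙xz _ _ x ⟩
      ι (ℤ.+ n ℚ./ 1) * (ι 1/n * x)    ≈⟨ *-assoc _ _ x ⟨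
      ι (ℤ.+ n ℚ./ 1) * ι 1/n * x      ≈⟨ *-congʳ (*-homo _ _) ⟨
      ι ((ℤ.+ n ℚ./ 1) ℚ.* 1/n) * x    ≡⟨ ≡.cong (λ q → ι q * x) (n/1*1/n≡1 n) ⟩
      ι ℚ.1ℚ * x                       ≈⟨ *-congʳ 1#-homo ⟩
      1# * x                           ≈⟨ *-identityˡ x ⟩
      x                                ∎
      where 1/n = ℤ.+ 1 ℚ./ n

    multiSum-zero : ∀ n m {F : Vector ℕ n → Carrier} → (∀ α → F α ≈ 0#) → multiSum n m F ≈ 0#
    multiSum-zero zero    m F≈0 = F≈0 []
    multiSum-zero (suc n) m F≈0 = trans
      (sum-cong-≋ {suc m} λ a → multiSum-zero n (m ∸ toℕ a) (λ β → F≈0 (toℕ a ∷ β)))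
      (sum-replicate-zero (suc m))

    -- The box lies inside the region of total degree at most `m`. The bound `m` is kept general
    -- because in the recursive call `m ∸ a` may exceed the size of `tail k`.
    multiSum≈boxSum : ∀ n (k : Vector ℕ n) m (F : Vector ℕ n → Carrier) → ∣ k ∣ ≤ m →
                      (∀ α j → k j < α j → F α ≈ 0#) → multiSum n m F ≈ boxSum k F
    multiSum≈boxSum zero    k m F _     F≈0 = refl
    multiSum≈boxSum (suc n) k m F ∣k∣≤m F≈0 = trans
      (sum-truncate (ℕ.m+n≤o⇒m≤o (head k) ∣k∣≤m)
        (λ a → multiSum n (m ∸ a) (λ β → F (a ∷ β)))
        (λ a k<a → multiSum-zero n (m ∸ a) (λ β → F≈0 (a ∷ β) zero k<a)))
      (sum-cong-≋ {suc (head k)} λ a →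
        multiSum≈boxSum n (tail k) (m ∸ toℕ a) (λ β → F (toℕ a ∷ β))
          -- The chain is `∣ tail k ∣ ≤ m ∸ head k ≤ m ∸ a`, by `a ≤ head k`.
          (ℕ.≤-trans (ℕ.m+n≤o⇒m≤o∸n _ (ℕ.≤-trans (ℕ.≤-reflexive (ℕ.+-comm _ (head k))) ∣k∣≤m))
                     (ℕ.∸-monoʳ-≤ m (toℕ≤pred[n] a)))
          (λ β j → F≈0 (toℕ a ∷ β) (suc j)))

    ^ᵐ≈0 : ∀ {n} (k : Vector ℕ n) (d : Vector Carrier n) → (∀ j → d j ∈ D (k j)) →
           ∀ α j → k j < α j → d ^ᵐ α ≈ 0#
    ^ᵐ≈0 k d d∈D α zero    k<α = trans (*-congʳ (∈D⇒^≈0 {k zero} (d∈D zero) k<α)) (zeroˡ _)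
    ^ᵐ≈0 k d d∈D α (suc j) k<α =
      trans (*-congˡ (^ᵐ≈0 (tail k) (tail d) (d∈D ∘ suc) (tail α) j k<α)) (zeroʳ _)

  -- Derivatives and polynomial coefficients in one variable.

  module _ (kl : KockLawvere) where

    open KockLawvere kl
    open PartialDerivatives (KockLawvere⇒1-KockLawvere kl)

    ∂-isSlope : ∀ {n} (i : Fin n) (f : Map n) x {d} → d ∈ D 1 →
                to f (updateAt x i (_+ d)) ≈ to f x + to (∂ i f) x * d
    ∂-isSlope i f x {d} = proj₁ (proj₂ (∂-spec i f x)) d

    ∂-unique : ∀ {n} (i : Fin n) (f : Map n) x {b} →
               (∀ d → d ∈ D 1 → to f (updateAt x i (_+ d)) ≈ to f x + b * d) →
               to (∂ i f) x ≈ b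
    ∂-unique i f x = proj₂ (proj₂ (∂-spec i f x))

    -- `fold` puts the additional `∂ i` outermost, while the induction on coefficients replaces `f`
    -- by `∂ i f` and so needs it innermost.
    ∂^-suc : ∀ {n} (i : Fin n) m (f : Map n) → ∂^ i (suc m) f ≡ ∂^ i m (∂ i f)
    ∂^-suc i m f = ≡.trans (iterate-is-fold f (∂ i) (suc m)) (≡.sym (iterate-is-fold (∂ i f) (∂ i) m))

    -- The order drops from `suc k` to `k` because the expansion of `f` is used at `d + e` for every
    -- `e ∈ D 1`, and this sum is only known to lie in `D (suc k)`.
    ∂-polynomial : ∀ {n} (i : Fin n) k (f : Map n) x (b : Vector Carrier (suc (suc k))) →
      (∀ d → d ∈ D (suc k) → to f (updateAt x i (_+ d)) ≈ ∑[ a ≤ suc k ] (b a * d ^ toℕ a)) →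
      ∀ d → d ∈ D k →
      to (∂ i f) (updateAt x i (_+ d)) ≈ ∑[ a ≤ k ] (suc (toℕ a) × b (suc a) * d ^ toℕ a)
    ∂-polynomial i k f x b f≈ d d∈D = ∂-unique i f _ λ e e∈D → begin
      to f (updateAt (updateAt x i (_+ d)) i (_+ e))
        ≈⟨ cong f (updateAt-+-+ x i d e) ⟩
      to f (updateAt x i (_+ (d + e)))
        ≈⟨ f≈ (d + e) (+-∈D {k} d∈D e∈D) ⟩
      b zero * 1# + ∑[ a ≤ k ] (b (suc a) * (d + e) ^ suc (toℕ a))
        ≈⟨ +-congˡ (sum-cong-≋ (term e e∈D)) ⟩
      b zero * 1# + ∑[ a ≤ k ] (b (suc a) * d ^ suc (toℕ a) + suc (toℕ a) × b (suc a) * d ^ toℕ a * e)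
        ≈⟨ +-congˡ (∑-distrib-+ {suc k} (λ a → b (suc a) * d ^ suc (toℕ a)) (λ a → suc (toℕ a) × b (suc a) * d ^ toℕ a * e)) ⟩
      b zero * 1# + (∑[ a ≤ k ] (b (suc a) * d ^ suc (toℕ a)) + ∑[ a ≤ k ] (suc (toℕ a) × b (suc a) * d ^ toℕ a * e))
        ≈⟨ +-assoc _ _ _ ⟨
      (b zero * 1# + ∑[ a ≤ k ] (b (suc a) * d ^ suc (toℕ a))) + ∑[ a ≤ k ] (suc (toℕ a) × b (suc a) * d ^ toℕ a * e)
        -- The part free of `e` is the expansion at `d` itself, so the factor of `e` in the rest is
        -- a slope at the shifted point.
        ≈⟨ +-cong (f≈ d (D-⊆-suc {k} d∈D)) (*-distribʳ-sum {suc k} e (λ a → suc (toℕ a) × b (suc a) * d ^ toℕ a)) ⟨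
      to f (updateAt x i (_+ d)) + ∑[ a ≤ k ] (suc (toℕ a) × b (suc a) * d ^ toℕ a) * e
        ∎
      where
      term : ∀ e → e ∈ D 1 → ∀ a → b (suc a) * (d + e) ^ suc (toℕ a) ≈
             b (suc a) * d ^ suc (toℕ a) + suc (toℕ a) × b (suc a) * d ^ toℕ a * e
      term e e∈D a = begin
        b′ * (d + e) ^ suc m                           ≈⟨ *-congˡ (^-+-∈D₁ d e∈D m) ⟩
        b′ * (d ^ suc m + suc m × (d ^ m * e))         ≈⟨ distribˡ b′ _ _ ⟩
        b′ * d ^ suc m + b′ * (suc m × (d ^ m * e))    ≈⟨ +-congˡ (×-comm-* (suc m) b′ _) ⟩
        b′ * d ^ suc m + suc m × (b′ * (d ^ m * e))    ≈⟨ +-congˡ (×-assoc-* (suc m) b′ _) ⟨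
        b′ * d ^ suc m + suc m × b′ * (d ^ m * e)      ≈⟨ +-congˡ (*-assoc _ _ e) ⟨
        b′ * d ^ suc m + suc m × b′ * d ^ m * e        ∎
        where
        b′ = b (suc a)
        m  = toℕ a

    -- The constant coefficient is read off at `d = 0`. A later one becomes a coefficient of `∂ i f`
    -- of index one less, and its factor `suc m` completes `m !` to the next factorial.
    polynomial-coefficient : ∀ {n} (i : Fin n) k (f : Map n) x (b : Vector Carrier (suc k)) →
      (∀ d → d ∈ D k → to f (updateAt x i (_+ d)) ≈ ∑[ a ≤ k ] (b a * d ^ toℕ a)) →
      ∀ a → (toℕ a !) × b a ≈ to (∂^ i (toℕ a) f) x
    polynomial-coefficient i k f x b f≈ zero = begin
      b zero + 0#                                              ≈⟨ +-identityʳ _ ⟩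
      b zero                                                   ≈⟨ *-identityʳ _ ⟨
      b zero * 1#                                              ≈⟨ +-identityʳ _ ⟨
      b zero * 1# + 0#                                         ≈⟨ +-congˡ (sum-replicate-zero k) ⟨
      -- Every term of positive degree contains a factor `0#` when `d` is `0#`.
      b zero * 1# + sum {k} (λ _ → 0#)                         ≈⟨ +-congˡ (sum-cong-≋ {k} (λ a → sym (trans (*-congˡ (zeroˡ _)) (zeroʳ _)))) ⟩
      b zero * 1# + ∑[ a < k ] (b (suc a) * 0# ^ suc (toℕ a))  ≈⟨ f≈ 0# (0∈D k) ⟨
      to f (updateAt x i (_+ 0#))                              ≈⟨ cong f (updateAt-+0 x i) ⟩
      to f x                                                   ∎
    polynomial-coefficient i (suc k) f x b f≈ (suc a) = begin
      (suc m ℕ.* (m !)) × b (suc a)      ≈⟨ ×-congˡ (ℕ.*-comm (suc m) (m !)) ⟩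
      ((m !) ℕ.* suc m) × b (suc a)      ≈⟨ ×-assocˡ (b (suc a)) (m !) (suc m) ⟨
      (m !) × (suc m × b (suc a))        ≈⟨ polynomial-coefficient i k (∂ i f) x (λ a → suc (toℕ a) × b (suc a)) (∂-polynomial i k f x b f≈) a ⟩
      to (∂^ i m (∂ i f)) x              ≡⟨ ≡.cong (λ g → to g x) (∂^-suc i m f) ⟨
      to (∂^ i (suc m) f) x              ∎
      where m = toℕ a

    -- Fixing the first coordinate.

    -- Pointwise agreement is assumed in place of `h` being literally a slice, so that the
    -- conclusion has the shape of the hypothesis and the lemma can be iterated.
    ∂-slice : ∀ {n} (i : Fin n) (f : Map (suc n)) (h : Map n) t →
              (∀ y → to h y ≈ to f (t ∷ y)) → ∀ y → to (∂ i h) y ≈ to (∂ (suc i) f) (t ∷ y)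
    ∂-slice i f h t h≈f y = ∂-unique i h y λ d d∈D → begin
      to h (updateAt y i (_+ d))                       ≈⟨ h≈f _ ⟩
      to f (t ∷ updateAt y i (_+ d))                   ≈⟨ cong f (λ { zero → refl ; (suc j) → refl }) ⟩
      to f (updateAt (t ∷ y) (suc i) (_+ d))           ≈⟨ ∂-isSlope (suc i) f (t ∷ y) d∈D ⟩
      to f (t ∷ y) + to (∂ (suc i) f) (t ∷ y) * d      ≈⟨ +-congʳ (h≈f y) ⟨
      to h y + to (∂ (suc i) f) (t ∷ y) * d            ∎

    ∂^-slice : ∀ {n} (i : Fin n) m (f : Map (suc n)) (h : Map n) t →
               (∀ y → to h y ≈ to f (t ∷ y)) → ∀ y → to (∂^ i m h) y ≈ to (∂^ (suc i) m f) (t ∷ y)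
    ∂^-slice i zero    f h t h≈f = h≈f
    ∂^-slice i (suc m) f h t h≈f = ∂-slice i (∂^ (suc i) m f) (∂^ i m h) t (∂^-slice i m f h t h≈f)

    slice : ∀ {n} → Map (suc n) → Carrier → Map n
    slice f t = record
      { to   = λ y → to f (t ∷ y)
      ; cong = λ y≋z → cong f (λ { zero → refl ; (suc j) → y≋z j })
      }

    -- `∂[_]` folds over `id`, whose tail is `suc ∘ id`; for `js = id` this separates the operators
    -- of the last variables from that of the first. A general `js` is needed since the recursion of
    -- `foldr` changes the vector.
    foldr-∂^-suc : ∀ {n} (α : Vector ℕ (suc n)) (f : Map (suc n)) {m} (js : Vector (Fin n) m) →
                   foldr (λ j → ∂^ j (α j)) f (suc ∘ js) ≡ foldr (λ j → ∂^ (suc j) (tail α j)) f js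
    foldr-∂^-suc α f {zero}  js = ≡.refl
    foldr-∂^-suc α f {suc m} js =
      ≡.cong (∂^ (suc (head js)) (α (suc (head js)))) (foldr-∂^-suc α f (tail js))

    foldr-∂^-slice : ∀ {n} (β : Vector ℕ n) (f : Map (suc n)) t {m} (js : Vector (Fin n) m) y →
                     to (foldr (λ j → ∂^ j (β j)) (slice f t) js) y ≈
                     to (foldr (λ j → ∂^ (suc j) (β j)) f js) (t ∷ y)
    foldr-∂^-slice β f t {zero}  js y = refl
    foldr-∂^-slice β f t {suc m} js y =
      ∂^-slice (head js) (β (head js))
        (foldr (λ j → ∂^ (suc j) (β j)) f (tail js))
        (foldr (λ j → ∂^ j (β j)) (slice f t) (tail js))
        t (foldr-∂^-slice β f t (tail js)) y

    -- Taylor expansion in one and in several variables.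

    module _ (ℚ-alg : ℚ-Algebra) where

      open ℚ-Algebra ℚ-alg
      open RingMorphisms ℚ.+-*-rawRing rawRing using (module IsRingHomomorphism)
      open IsRingHomomorphism isRingHomomorphism using (*-homo; 1#-homo)

      taylor : ∀ {n} (i : Fin n) k (f : Map n) x {d} → d ∈ D k →
        to f (updateAt x i (_+ d)) ≈
        ∑[ a ≤ k ] (to (∂^ i (toℕ a) f) x * (inv! (toℕ a) · d ^ toℕ a))
      taylor i k f x {d} d∈D = trans (f≈ d d∈D) (sum-cong-≋ {suc k} λ a → begin
        b a * d ^ toℕ a
          ≈⟨ *-congʳ (1/n·n×x≈x ℚ-alg (toℕ a !) {{toℕ a ℕ.!≢0}} (b a)) ⟨
        (inv! (toℕ a) · ((toℕ a !) × b a)) * d ^ toℕ a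
          ≈⟨ *-congʳ (*-congˡ (polynomial-coefficient i k f x b f≈ a)) ⟩
        (inv! (toℕ a) · to (∂^ i (toℕ a) f) x) * d ^ toℕ a
          ≈⟨ trans (*-assoc _ _ _) (x∙yz≈y∙xz _ _ _) ⟩
        to (∂^ i (toℕ a) f) x * (inv! (toℕ a) · d ^ toℕ a)
          ∎)
        where
        g : Func (D-setoid k) setoid
        g = record
          { to   = λ (d , _) → to f (updateAt x i (_+ d))
          ; cong = λ d≈e → cong f (updateAt-cong i (λ _ → refl) d≈e)
          }
        b : Vector Carrier (suc k)
        -- The Kock-Lawvere coefficients start in degree one, so the value at `x` is prepended as
        -- the coefficient of degree zero.
        b = to f x ∷ proj₁ (coefficients k g)
        f≈ : ∀ d → d ∈ D k → to f (updateAt x i (_+ d)) ≈ ∑[ a ≤ k ] (b a * d ^ toℕ a)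
        f≈ d d∈D = trans (proj₁ (proj₂ (coefficients k g)) d d∈D)
          (+-congʳ (trans (cong f (updateAt-+0 x i)) (sym (*-identityʳ _))))

      boxTaylor : ∀ n (k : Vector ℕ n) (f : Map n) (x d : Vector Carrier n) →
                  (∀ j → d j ∈ D (k j)) →
                  to f (x +ᵛ d) ≈ boxSum k (λ α → to (∂[ α ] f) x * (1/ α ! · d ^ᵐ α))
      boxTaylor zero k f x d d∈D = begin
        to f (x +ᵛ d)                     ≈⟨ cong f (λ ()) ⟩
        to f x                            ≈⟨ *-identityʳ _ ⟨
        to f x * 1#                       ≈⟨ *-congˡ (trans (*-congʳ 1#-homo) (*-identityˡ 1#)) ⟨
        to f x * (ι ℚ.1ℚ * 1#)            ∎
      boxTaylor (suc n) k f x d d∈D = begin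
        to f (x +ᵛ d)
          ≈⟨ cong f (λ { zero → refl ; (suc j) → refl }) ⟩
        to (slice f t) (tail x +ᵛ tail d)
          -- The first coordinate is frozen at its shifted value `t`; its increment `head d` is
          -- expanded only in `expand`.
          ≈⟨ boxTaylor n (tail k) (slice f t) (tail x) (tail d) (d∈D ∘ suc) ⟩
        boxSum (tail k) (λ β → to (∂[ β ] (slice f t)) (tail x) * (1/ β ! · tail d ^ᵐ β))
          ≈⟨ boxSum-cong (tail k) expand ⟩
        boxSum (tail k) (λ β → ∑[ a ≤ head k ] (to (∂[ toℕ a ∷ β ] f) x * (1/ (toℕ a ∷ β) ! · d ^ᵐ (toℕ a ∷ β))))
          ≈⟨ boxSum-∑-comm (tail k) (suc (head k)) (λ a β → to (∂[ toℕ a ∷ β ] f) x * (1/ (toℕ a ∷ β) ! · d ^ᵐ (toℕ a ∷ β))) ⟩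
        boxSum k (λ α → to (∂[ α ] f) x * (1/ α ! · d ^ᵐ α))
          ∎
        where
        t = head x + head d
        expand : ∀ β → to (∂[ β ] (slice f t)) (tail x) * (1/ β ! · tail d ^ᵐ β) ≈
                 ∑[ a ≤ head k ] (to (∂[ toℕ a ∷ β ] f) x * (1/ (toℕ a ∷ β) ! · d ^ᵐ (toℕ a ∷ β)))
        expand β = begin
          to (∂[ β ] (slice f t)) (tail x) * r
            ≈⟨ *-congʳ (foldr-∂^-slice β f t id (tail x)) ⟩
          to g (t ∷ tail x) * r
            -- The point `t ∷ tail x` is `x` with coordinate `zero` moved by `head d`, which is the
            -- form that `taylor` expects.
            ≈⟨ *-congʳ (cong g (λ { zero → refl ; (suc j) → refl })) ⟩
          to g (updateAt x zero (_+ head d)) * r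
            ≈⟨ *-congʳ (taylor zero (head k) g x (d∈D zero)) ⟩
          ∑[ a ≤ head k ] (to (∂^ zero (toℕ a) g) x * (inv! (toℕ a) · head d ^ toℕ a)) * r
            ≈⟨ *-distribʳ-sum {suc (head k)} r (λ a → to (∂^ zero (toℕ a) g) x * (inv! (toℕ a) · head d ^ toℕ a)) ⟩
          ∑[ a ≤ head k ] (to (∂^ zero (toℕ a) g) x * (inv! (toℕ a) · head d ^ toℕ a) * r)
            ≈⟨ sum-cong-≋ {suc (head k)} (λ a → trans (*-assoc _ _ r) (*-cong (∂^g a) (coeff (toℕ a)))) ⟩
          ∑[ a ≤ head k ] (to (∂[ toℕ a ∷ β ] f) x * (1/ (toℕ a ∷ β) ! · d ^ᵐ (toℕ a ∷ β)))
            ∎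
          where
          r = 1/ β ! · tail d ^ᵐ β
          -- The mixed derivative of `f` in all variables but the first. Applying powers of `∂ zero`
          -- to it gives exactly the operators of `∂[ a ∷ β ]`, in the same order.
          g = foldr (λ j → ∂^ (suc j) (β j)) f id
          ∂^g : ∀ (a : Fin (suc (head k))) → to (∂^ zero (toℕ a) g) x ≈ to (∂[ toℕ a ∷ β ] f) x
          ∂^g a = reflexive (≡.cong (λ h → to (∂^ zero (toℕ a) h) x) (≡.sym (foldr-∂^-suc (toℕ a ∷ β) f id)))
          coeff : ∀ a → (inv! a · head d ^ a) * r ≈ 1/ (a ∷ β) ! · d ^ᵐ (a ∷ β)
          coeff a = begin
            (ι (inv! a) * head d ^ a) * (ι (1/ β !) * tail d ^ᵐ β)   ≈⟨ interchange _ _ _ _ ⟩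
            (ι (inv! a) * ι (1/ β !)) * d ^ᵐ (a ∷ β)                 ≈⟨ *-congʳ (*-homo _ _) ⟨
            ι (inv! a ℚ.* 1/ β !) * d ^ᵐ (a ∷ β)
              ≡⟨ ≡.cong (λ q → ι q * d ^ᵐ (a ∷ β)) (1/[m*n]≡1/m*1/n (a !) (β !ᵐ) {{a ℕ.!≢0}} {{β !ᵐ≢0}} {{(a ∷ β) !ᵐ≢0}}) ⟨
            ι (1/ (a ∷ β) !) * d ^ᵐ (a ∷ β)                         ∎

theorem5p2p4 :
    ∀ {c ℓ} (R : CommutativeRing c ℓ) →
    let open CommutativeRing R
        open OverRing R
    in
    (kl : KockLawvere) (ℚ-alg : ℚ-Algebra) →
    let open PartialDerivatives (KockLawvere⇒1-KockLawvere kl)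
        open ℚ-Algebra ℚ-alg
        open Func
    in
    (n : ℕ) (k : Vector ℕ n) (f : Map n) (x d : Vector Carrier n) →
    (∀ j → d j ∈ D (k j)) →
    to f (x +ᵛ d) ≈ ∑[ α ∈ℕ^ n ∣≤ ∣ k ∣ ] (to (∂[ α ] f) x * (1/ α ! · d ^ᵐ α))
theorem5p2p4 R kl ℚ-alg n k f x d d∈D =
  trans (boxTaylor R kl ℚ-alg n k f x d d∈D)
    (sym (multiSum≈boxSum R ℚ-alg n k ∣ k ∣ _ ℕ.≤-refl
      -- Outside the box the monomial `d ^ᵐ α` is zero, and it is a factor of the term.
      (λ α j k<α → trans (*-congˡ (trans (*-congˡ (^ᵐ≈0 R ℚ-alg k d d∈D α j k<α)) (zeroʳ _))) (zeroʳ _))))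
  where open CommutativeRing R
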